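{- Let $(\mathcal{S}^x,G)$ be a finite thick EGQ of order $(s,t)$ with $s>t$, and suppose $st$ is a power of the prime $p$. Let $a\in G\setminus\{\mathrm{id}\}$ be such that all points fixed by $a$ lie on a single line $L_a$ through $x$, and suppose that $\alpha(a)$, defined by $\alpha(a)+1=$ the number of points of $L_a$ fixed by $a$, is a power of $p$. Then: (i) the number $f(a)$ of affine lines fixed by $a$ is nonzero; (ii) if moreover $f(a)$ is a power of $p$, then $\alpha(a)/f(a)=(s/t)^{o(a)}$ for some even integer $o(a)$.
   Context: A finite GQ of order $(s,t)$: every line has $s+1$ points, every point lies on $t+1$ lines, and for each point $p$ and line $L$ not through $p$ exactly one point of $L$ is collinear with $p$; thick means $s,t\ge2$. An EGQ $(\mathcal{S}^x,G)$: $G\le\mathrm{Aut}(\mathcal{S})$ fixes every line through $x$ and acts sharply transitively on the points not collinear with $x$. Affine lines are lines not incident with $x$. -}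

module Defs where

open import Data.Nat using (ℕ; zero; suc; _+_; _*_; _^_)
open import Data.Bool using (Bool; true; false; if_then_else_; _∧_; not)
open import Data.Fin using (Fin; _≟_)
import Data.Fin as F
open import Data.Product using (Σ; Σ-syntax; ∃; ∃-syntax; _×_; _,_)
open import Data.Integer using (ℤ; +_; -[1+_])
open import Relation.Binary.PropositionalEquality using (_≡_; _≢_; _≗_)
open import Relation.Nullary using (¬_)
open import Relation.Nullary.Decidable using (⌊_⌋)
open import Function using (_∘_; id)

countF : ∀ {n} → (Fin n → Bool) → ℕ
countF {zero}  f = 0
countF {suc n} f = (if f F.zero then 1 else 0) + countF (f ∘ F.suc)

Incidence : ℕ → ℕ → Set
Incidence np nl = Fin np → Fin nl → Bool

module _ {np nl : ℕ} (I : Incidence np nl) where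

  Collinear : Fin np → Fin np → Set
  Collinear p q = Σ[ L ∈ Fin nl ] (I p L ≡ true × I q L ≡ true)

  -- generalized quadrangle of order (s,t) (Payne–Thas definition)
  record IsGQ (s t : ℕ) : Set where
    field
      lineSize   : ∀ L → countF (λ p → I p L) ≡ suc s
      pointDeg   : ∀ p → countF (λ L → I p L) ≡ suc t
      atMostOne  : ∀ p q L M → p ≢ q → I p L ≡ true → I q L ≡ true →
                   I p M ≡ true → I q M ≡ true → L ≡ M
      gqAxiom    : ∀ p L → I p L ≡ false →
                   Σ[ q ∈ Fin np ] ((I q L ≡ true × Collinear p q) ×
                     (∀ q' → I q' L ≡ true → Collinear p q' → q' ≡ q))

  record Aut : Set where
    field
      pt    : Fin np → Fin np
      ln    : Fin nl → Fin nl
      ptInv : Fin np → Fin np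
      lnInv : Fin nl → Fin nl
      ptInvˡ : ∀ p → ptInv (pt p) ≡ p
      ptInvʳ : ∀ p → pt (ptInv p) ≡ p
      lnInvˡ : ∀ L → lnInv (ln L) ≡ L
      lnInvʳ : ∀ L → ln (lnInv L) ≡ L
      preserves : ∀ p L → I (pt p) (ln L) ≡ I p L
  open Aut public

  record IsAutGroup (G : Aut → Set) : Set where
    field
      hasId   : Σ[ e ∈ Aut ] (G e × (pt e ≗ id) × (ln e ≗ id))
      hasComp : ∀ g h → G g → G h →
                Σ[ k ∈ Aut ] (G k × (pt k ≗ pt g ∘ pt h) × (ln k ≗ ln g ∘ ln h))
      hasInv  : ∀ g → G g →
                Σ[ k ∈ Aut ] (G k × (pt k ≗ ptInv g) × (ln k ≗ lnInv g))

  record IsEGQ (s t : ℕ) (x : Fin np) (G : Aut → Set) : Set where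
    field
      isGQ       : IsGQ s t
      isGroup    : IsAutGroup G
      fixesLines : ∀ g → G g → ∀ L → I x L ≡ true → ln g L ≡ L
      transitive : ∀ y z → ¬ Collinear x y → ¬ Collinear x z →
                   Σ[ g ∈ Aut ] (G g × pt g y ≡ z)
      sharp      : ∀ y → ¬ Collinear x y → ∀ g h → G g → G h →
                   pt g y ≡ pt h y → (pt g ≗ pt h) × (ln g ≗ ln h)

  fixedPointsOn : Aut → Fin nl → ℕ
  fixedPointsOn a L = countF (λ q → I q L ∧ ⌊ pt a q ≟ q ⌋)

  fixedAffineLines : Fin np → Aut → ℕ
  fixedAffineLines x a = countF (λ L → not (I x L) ∧ ⌊ ln a L ≟ L ⌋)

-- α / f = (s / t) ^ o, cross-multiplied (all quantities positive naturals here)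
RatioPow : (α f s t : ℕ) → ℤ → Set
RatioPow α f s t (+ n)      = α * t ^ n ≡ f * s ^ n
RatioPow α f s t -[1+ n ]   = α * s ^ suc n ≡ f * t ^ suc n

IsPowerOf : ℕ → ℕ → Set
IsPowerOf p n = ∃[ k ] (n ≡ p ^ k)

{-# OPTIONS --safe #-}
module Submission where

-- Let M be the matrix counting the lines through two points; the GQ axiom says M D = (s + t) D + J
-- for the point-line incidence matrix D. Subtracting the row of x from every row of D gives an
-- integer matrix E with (E Dᵀ) E = (s + t) E, and a, which fixes all lines through x, permutes the
-- rows of E by permuting its columns. Writing the permuted E Dᵀ in a ℤ-basis of the lattice spanned
-- by the columns of E shows that its trace is divisible by s + t (a form of Benson's theorem).
-- Counting line by line, the trace equals s f(a) + t α(a). With s = t q and q = pⁿ this leaves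
-- q + 1 ∣ q f(a) + α(a). Since q + 1 is prime to p, f(a) ≠ 0; and since p has order 2n modulo q + 1,
-- the exponents of the powers f(a) and α(a) of p differ by a multiple of 2n.

open import Defs

-- Integer matrices, finite sums and traces.

module IntegerMatrices where

  open import Data.Nat using (ℕ; zero; suc)
  import Data.Nat as ℕ
  open import Data.Nat.GCD using (module Bézout; module GCD)
  import Data.Nat.Divisibility as ℕ
  open import Data.Integer hiding (suc)
  open import Data.Integer.Properties
  open import Data.Integer.Divisibility.Signed using (_∣_; divides)
  open import Data.Integer.Tactic.RingSolver using (solve-∀)
  open import Data.Fin using (Fin; zero; suc)
  open import Data.Product using (Σ-syntax; _,_; proj₁; proj₂)
  open import Relation.Binary.PropositionalEquality
  open import Relation.Nullary using (yes; no)
  open import Algebra.Properties.Semiring.Sum +-*-semiring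
  open ≡-Reasoning

  Matrix : ℕ → ℕ → Set
  Matrix m n = Fin m → Fin n → ℤ

  infix 4 _≋_
  _≋_ : ∀ {m n} → Matrix m n → Matrix m n → Set
  A ≋ B = ∀ i j → A i j ≡ B i j

  infixl 7 _⊛_
  _⊛_ : ∀ {m k n} → Matrix m k → Matrix k n → Matrix m n
  _⊛_ {k = k} A B i j = ∑[ l < k ] (A i l * B l j)

  trace : ∀ {n} → Matrix n n → ℤ
  trace {n} A = ∑[ i < n ] A i i

  δ : ∀ {n} → Matrix n n
  δ zero    zero    = 1ℤ
  δ zero    (suc j) = 0ℤ
  δ (suc i) zero    = 0ℤ
  δ (suc i) (suc j) = δ i j

  sum-zero : ∀ {n} {f : Fin n → ℤ} → (∀ i → f i ≡ 0ℤ) → sum f ≡ 0ℤ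
  sum-zero {n} f≡0 = trans (sum-cong-≗ f≡0) (sum-replicate-zero n)

  sum-*δ : ∀ {n} (f : Fin n → ℤ) l → ∑[ j < n ] (f j * δ j l) ≡ f l
  sum-*δ {suc n} f zero = begin
    f zero * 1ℤ + ∑[ j < n ] (f (suc j) * 0ℤ)
      ≡⟨ cong₂ _+_ (*-identityʳ (f zero)) (sum-zero λ j → *-zeroʳ (f (suc j))) ⟩
    f zero + 0ℤ  ≡⟨ +-identityʳ _ ⟩
    f zero       ∎
  sum-*δ {suc n} f (suc l) = begin
    f zero * 0ℤ + ∑[ j < n ] (f (suc j) * δ j l)
      ≡⟨ cong₂ _+_ (*-zeroʳ (f zero)) (sum-*δ (λ j → f (suc j)) l) ⟩
    0ℤ + f (suc l)  ≡⟨ +-identityˡ _ ⟩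
    f (suc l)       ∎

  sum-- : ∀ {n} (f g : Fin n → ℤ) → ∑[ i < n ] (f i - g i) ≡ sum f - sum g
  sum-- {zero}  f g = refl
  sum-- {suc n} f g = trans (cong (_+_ (f zero - g zero)) (sum-- (λ i → f (suc i)) (λ i → g (suc i))))
    (regroup (f zero) (g zero) (∑[ i < n ] f (suc i)) (∑[ i < n ] g (suc i)))
    where
    regroup : ∀ a b c d → (a - b) + (c - d) ≡ (a + c) - (b + d)
    regroup = solve-∀

  ⊛-cong : ∀ {m k n} {A A′ : Matrix m k} {B B′ : Matrix k n} → A ≋ A′ → B ≋ B′ → A ⊛ B ≋ A′ ⊛ B′
  ⊛-cong A≋A′ B≋B′ i j = sum-cong-≗ λ l → cong₂ _*_ (A≋A′ i l) (B≋B′ l j)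

  ⊛-congˡ : ∀ {m k n} {A : Matrix m k} {B B′ : Matrix k n} → B ≋ B′ → A ⊛ B ≋ A ⊛ B′
  ⊛-congˡ {A = A} = ⊛-cong {A = A} λ _ _ → refl

  ⊛-congʳ : ∀ {m k n} {A A′ : Matrix m k} {B : Matrix k n} → A ≋ A′ → A ⊛ B ≋ A′ ⊛ B
  ⊛-congʳ {B = B} A≋A′ = ⊛-cong {B = B} A≋A′ λ _ _ → refl

  ⊛-assoc : ∀ {m k l n} (A : Matrix m k) (B : Matrix k l) (C : Matrix l n) →
            (A ⊛ B) ⊛ C ≋ A ⊛ (B ⊛ C)
  ⊛-assoc {m} {k} {l} A B C i j = begin
    ∑[ b < l ] (∑[ a < k ] (A i a * B a b) * C b j)
      ≡⟨ sum-cong-≗ (λ b → *-distribʳ-sum (C b j) (λ a → A i a * B a b)) ⟩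
    ∑[ b < l ] ∑[ a < k ] (A i a * B a b * C b j)
      ≡⟨ ∑-comm (λ b a → A i a * B a b * C b j) ⟩
    ∑[ a < k ] ∑[ b < l ] (A i a * B a b * C b j)
      ≡⟨ sum-cong-≗ (λ a → sum-cong-≗ (λ b → *-assoc (A i a) (B a b) (C b j))) ⟩
    ∑[ a < k ] ∑[ b < l ] (A i a * (B a b * C b j))
      ≡⟨ sum-cong-≗ (λ a → *-distribˡ-sum (A i a) (λ b → B a b * C b j)) ⟨
    ∑[ a < k ] (A i a * ∑[ b < l ] (B a b * C b j)) ∎

  trace-comm : ∀ {m n} (A : Matrix m n) (B : Matrix n m) → trace (A ⊛ B) ≡ trace (B ⊛ A)
  trace-comm A B = trans (∑-comm (λ i l → A i l * B l i))
    (sum-cong-≗ λ l → sum-cong-≗ λ i → *-comm (A i l) (B l i))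

  -- Bezout identities and bases of column lattices.

  record Bezout (a b : ℤ) : Set where
    field
      g x y c e : ℤ
      combination : g ≡ x * a + y * b
      a-multiple  : a ≡ g * c
      b-multiple  : b ≡ g * e

  bezoutℕ : ∀ a b → Bezout (+ a) (+ b)
  bezoutℕ a b with Bézout.lemma a b
  ... | Bézout.result d gcd identity = record
    { g = + d ; x = proj₁ (coeffs identity) ; y = proj₁ (proj₂ (coeffs identity))
    ; c = + ℕ.quotient (proj₁ common) ; e = + ℕ.quotient (proj₂ common)
    ; combination = proj₂ (proj₂ (coeffs identity))
    ; a-multiple = multiple (proj₁ common)
    ; b-multiple = multiple (proj₂ common)
    }
    where
    common = GCD.commonDivisor gcd
    multiple : ∀ {m} (d∣m : d ℕ.∣ m) → + m ≡ + d * + ℕ.quotient d∣m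
    multiple (ℕ.divides q refl) = trans (pos-* q d) (*-comm (+ q) (+ d))
    isolate : ∀ u v w z → u + v * w ≡ z → u ≡ z + - v * w
    isolate u v w z eq = trans (lem u v w) (cong (_+ - v * w) eq)
      where
      lem : ∀ u v w → u ≡ (u + v * w) + - v * w
      lem = solve-∀
    -- The identity over ℕ keeps the subtracted product on the left; over ℤ it moves to the right
    -- with a negative coefficient.
    lift : ∀ x y m n → d ℕ.+ y ℕ.* n ≡ x ℕ.* m → + d ≡ + x * + m + - + y * + n
    lift x y m n eq = isolate (+ d) (+ y) (+ n) (+ x * + m)
      (trans (cong (_+_ (+ d)) (sym (pos-* y n))) (trans (cong +_ eq) (pos-* x m)))
    coeffs : Bézout.Identity d a b → Σ[ x ∈ ℤ ] Σ[ y ∈ ℤ ] + d ≡ x * + a + y * + b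
    coeffs (Bézout.+- x y eq) = + x , - + y , lift x y a b eq
    coeffs (Bézout.-+ x y eq) = - + x , + y , trans (lift y x b a eq) (+-comm (+ y * + b) _)

  negˡ : ∀ {a b} → Bezout a b → Bezout (- a) b
  negˡ {a} {b} B = record
    { g = g ; x = - x ; y = y ; c = - c ; e = e
    ; combination = trans combination (lem x a (y * b))
    ; a-multiple = trans (cong -_ a-multiple) (neg-distribʳ-* g c)
    ; b-multiple = b-multiple
    }
    where
    open Bezout B
    lem : ∀ x a z → x * a + z ≡ - x * - a + z
    lem = solve-∀

  swap : ∀ {a b} → Bezout a b → Bezout b a
  swap {a} {b} B = record
    { g = g ; x = y ; y = x ; c = e ; e = c
    ; combination = trans combination (+-comm (x * a) (y * b))
    ; a-multiple = b-multiple ; b-multiple = a-multiple }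
    where open Bezout B

  bezout : ∀ a b → Bezout a b
  bezout (+ m)     (+ n)     = bezoutℕ m n
  bezout (+ m)     -[1+ n ]  = swap (negˡ (swap (bezoutℕ m (suc n))))
  bezout -[1+ m ]  (+ n)     = negˡ (bezoutℕ (suc m) n)
  bezout -[1+ m ]  -[1+ n ]  = negˡ (swap (negˡ (swap (bezoutℕ (suc m) (suc n)))))

  -- `g` generates the ideal spanned by the entries of `b`. Neither its sign nor its nonvanishing is
  -- prescribed, so empty and zero vectors are covered.
  record VectorBezout {k} (b : Fin k → ℤ) : Set where
    field
      g           : ℤ
      u w         : Fin k → ℤ
      combination : g ≡ ∑[ l < k ] (b l * u l)
      multiple    : ∀ l → b l ≡ g * w l

  vectorBezout : ∀ {k} (b : Fin k → ℤ) → VectorBezout b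
  vectorBezout {zero} b = record
    { g = 0ℤ ; u = λ () ; w = λ () ; combination = refl ; multiple = λ () }
  vectorBezout {suc k} b = record
    { g = B.g
    ; u = λ { zero → B.x ; (suc l) → T.u l * B.y }
    ; w = λ { zero → B.c ; (suc l) → B.e * T.w l }
    ; combination = begin
        B.g                                  ≡⟨ B.combination ⟩
        B.x * b zero + B.y * T.g             ≡⟨ cong₂ _+_ (*-comm B.x (b zero)) (*-comm B.y T.g) ⟩
        b zero * B.x + T.g * B.y             ≡⟨ cong (λ z → b zero * B.x + z * B.y) T.combination ⟩
        b zero * B.x + ∑[ l < k ] (b (suc l) * T.u l) * B.y
          ≡⟨ cong (_+_ (b zero * B.x)) (*-distribʳ-sum B.y (λ l → b (suc l) * T.u l)) ⟩
        b zero * B.x + ∑[ l < k ] (b (suc l) * T.u l * B.y)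
          ≡⟨ cong (_+_ (b zero * B.x)) (sum-cong-≗ λ l → *-assoc (b (suc l)) (T.u l) B.y) ⟩
        b zero * B.x + ∑[ l < k ] (b (suc l) * (T.u l * B.y)) ∎
    ; multiple = λ
        { zero → B.a-multiple
        ; (suc l) → begin
            b (suc l)              ≡⟨ T.multiple l ⟩
            T.g * T.w l            ≡⟨ cong (_* T.w l) B.b-multiple ⟩
            B.g * B.e * T.w l      ≡⟨ *-assoc B.g B.e (T.w l) ⟩
            B.g * (B.e * T.w l)    ∎ }
    }
    where
    module T = VectorBezout (vectorBezout (λ l → b (suc l)))
    module B = Bezout (bezout (b zero) T.g)

  -- A ℤ-basis of the lattice spanned by the columns of `B`: the integer matrices `U` and `V`
  -- witness the two inclusions of lattices, and `injective` is linear independence.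
  record ColumnBasis {v k} (B : Matrix v k) : Set where
    field
      rank      : ℕ
      basis     : Matrix v rank
      U         : Matrix k rank
      V         : Matrix rank k
      basis≋B⊛U : basis ≋ B ⊛ U
      B≋basis⊛V : B ≋ basis ⊛ V
      injective : ∀ (z : Fin rank → ℤ) → (∀ i → ∑[ j < rank ] (basis i j * z j) ≡ 0ℤ) → ∀ j → z j ≡ 0ℤ

  -- One step of Hermite reduction: if the first row is g·w with g = row·u ≠ 0, then B u starts the
  -- basis and B (1 − u wᵀ), whose first row vanishes, provides the rest.
  columnBasis : ∀ {v k} (B : Matrix v k) → ColumnBasis B
  columnBasis {zero} B = record
    { rank = 0 ; basis = λ () ; U = λ _ () ; V = λ () ; basis≋B⊛U = λ () ; B≋basis⊛V = λ ()
    ; injective = λ _ _ () }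
  columnBasis {suc v} {k} B with vectorBezout (B zero)
  ... | record { g = g ; u = u ; w = w ; combination = g≡ ; multiple = row≡ } with g ≟ 0ℤ
  -- With `g` zero the first row of `B` vanishes, so a basis for the remaining rows is padded with a
  -- zero row.
  ... | yes refl = record
    { rank = T.rank
    ; basis = λ { zero j → 0ℤ ; (suc i) j → T.basis i j }
    ; U = T.U ; V = T.V
    ; basis≋B⊛U = λ
        { zero j → sym (sum-zero λ l → trans (cong (_* T.U l j) (row≡ l)) (*-zeroˡ (T.U l j)))
        ; (suc i) → T.basis≋B⊛U i }
    ; B≋basis⊛V = λ
        { zero l → trans (row≡ l) (sym (sum-zero {f = λ j → 0ℤ * T.V j l} λ j → refl))
        ; (suc i) → T.B≋basis⊛V i }
    ; injective = λ z eq → T.injective z λ i → eq (suc i)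
    }
    where module T = ColumnBasis (columnBasis (λ i → B (suc i)))
  ... | no g≢0 = record
    { rank = suc T.rank ; basis = basis ; U = U ; V = V
    ; basis≋B⊛U = basis≋ ; B≋basis⊛V = B≋ ; injective = injective }
    where
    Bu : Fin (suc v) → ℤ
    Bu i = ∑[ l < k ] (B i l * u l)
    module T = ColumnBasis (columnBasis (λ i l → B (suc i) l - Bu (suc i) * w l))
    basis : Matrix (suc v) (suc T.rank)
    basis i       zero    = Bu i
    basis zero    (suc j) = 0ℤ
    basis (suc i) (suc j) = T.basis i j
    wU : Fin T.rank → ℤ
    wU j = ∑[ m < k ] (w m * T.U m j)
    -- The later columns are `(1 − u wᵀ) T.U`: the reduced matrix is `B (1 − u wᵀ)`, so its
    -- coefficients are pulled back to `B`.
    U : Matrix k (suc T.rank)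
    U l zero    = u l
    U l (suc j) = T.U l j - u l * wU j
    V : Matrix (suc T.rank) k
    V zero    = w
    V (suc j) = T.V j
    B⊛U : ∀ i j → (B ⊛ U) i (suc j) ≡ ∑[ l < k ] ((B i l - Bu i * w l) * T.U l j)
    B⊛U i j = begin
      ∑[ l < k ] (B i l * (T.U l j - u l * wU j))
        ≡⟨ sum-cong-≗ (λ l → distr (B i l) (T.U l j) (u l) (wU j)) ⟩
      ∑[ l < k ] (B i l * T.U l j - B i l * u l * wU j)
        ≡⟨ sum-- (λ l → B i l * T.U l j) (λ l → B i l * u l * wU j) ⟩
      ∑[ l < k ] (B i l * T.U l j) - ∑[ l < k ] (B i l * u l * wU j)
        ≡⟨ cong (λ z → ∑[ l < k ] (B i l * T.U l j) - z) (*-distribʳ-sum (wU j) (λ l → B i l * u l)) ⟨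
      ∑[ l < k ] (B i l * T.U l j) - Bu i * wU j
        ≡⟨ cong (λ z → ∑[ l < k ] (B i l * T.U l j) - z) (*-distribˡ-sum (Bu i) (λ l → w l * T.U l j)) ⟩
      ∑[ l < k ] (B i l * T.U l j) - ∑[ l < k ] (Bu i * (w l * T.U l j))
        ≡⟨ sum-- (λ l → B i l * T.U l j) (λ l → Bu i * (w l * T.U l j)) ⟨
      ∑[ l < k ] (B i l * T.U l j - Bu i * (w l * T.U l j))
        ≡⟨ sum-cong-≗ (λ l → factor (B i l) (T.U l j) (Bu i) (w l)) ⟩
      ∑[ l < k ] ((B i l - Bu i * w l) * T.U l j) ∎
      where
      distr : ∀ b t u c → b * (t - u * c) ≡ b * t - b * u * c
      distr = solve-∀
      factor : ∀ b t c w → b * t - c * (w * t) ≡ (b - c * w) * t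
      factor = solve-∀
    basis≋ : basis ≋ B ⊛ U
    basis≋ i       zero    = refl
    basis≋ zero    (suc j) = sym (trans (B⊛U zero j) (sum-zero λ l →
      cong (_* T.U l j) (begin
        B zero l - Bu zero * w l  ≡⟨ cong (λ z → B zero l - z * w l) g≡ ⟨
        B zero l - g * w l        ≡⟨ cong (_-_ (B zero l)) (row≡ l) ⟨
        B zero l - B zero l       ≡⟨ +-inverseʳ (B zero l) ⟩
        0ℤ                        ∎)))
    basis≋ (suc i) (suc j) = trans (T.basis≋B⊛U i j) (sym (B⊛U (suc i) j))
    B≋ : B ≋ basis ⊛ V
    B≋ zero l = begin
      B zero l            ≡⟨ row≡ l ⟩
      g * w l             ≡⟨ cong (_* w l) g≡ ⟩
      Bu zero * w l       ≡⟨ +-identityʳ _ ⟨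
      Bu zero * w l + 0ℤ  ≡⟨ cong (_+_ (Bu zero * w l)) (sum-zero {f = λ j → 0ℤ * T.V j l} λ j → refl) ⟨
      (basis ⊛ V) zero l  ∎
    B≋ (suc i) l = begin
      B (suc i) l                                                    ≡⟨ lem (B (suc i) l) (Bu (suc i) * w l) ⟩
      Bu (suc i) * w l + (B (suc i) l - Bu (suc i) * w l)            ≡⟨ cong (_+_ (Bu (suc i) * w l)) (T.B≋basis⊛V i l) ⟩
      (basis ⊛ V) (suc i) l                                          ∎
      where
      lem : ∀ b c → b ≡ c + (b - c)
      lem = solve-∀
    injective : ∀ (z : Fin (suc T.rank) → ℤ) → (∀ i → ∑[ j < suc T.rank ] (basis i j * z j) ≡ 0ℤ) → ∀ j → z j ≡ 0ℤ
    injective z eq = λ { zero → z₀≡0 ; (suc j) → T.injective (λ j → z (suc j)) tail-eq j }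
      where
      -- The first row of `basis` is `g` followed by zeros, so a relation gives `g * z zero ≡ 0ℤ`,
      -- and `g` is nonzero.
      z₀≡0 : z zero ≡ 0ℤ
      z₀≡0 = *-cancelˡ-≡ g (z zero) 0ℤ {{≢-nonZero g≢0}} (begin
        g * z zero             ≡⟨ cong (_* z zero) g≡ ⟩
        Bu zero * z zero       ≡⟨ +-identityʳ _ ⟨
        Bu zero * z zero + 0ℤ  ≡⟨ cong (_+_ (Bu zero * z zero)) (sum-zero {f = λ j → 0ℤ * z (suc j)} λ j → refl) ⟨
        _                      ≡⟨ eq zero ⟩
        0ℤ                     ≡⟨ *-zeroʳ g ⟨
        g * 0ℤ                 ∎)
      tail-eq : ∀ i → ∑[ j < T.rank ] (T.basis i j * z (suc j)) ≡ 0ℤ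
      tail-eq i = begin
        S                            ≡⟨ +-identityˡ S ⟨
        0ℤ + S                       ≡⟨ cong (_+ S) (*-zeroʳ (Bu (suc i))) ⟨
        Bu (suc i) * 0ℤ + S          ≡⟨ cong (λ y → Bu (suc i) * y + S) z₀≡0 ⟨
        Bu (suc i) * z zero + S      ≡⟨ eq (suc i) ⟩
        0ℤ                           ∎
        where S = ∑[ j < T.rank ] (T.basis i j * z (suc j))

  -- Written in a basis B′ of the lattice spanned by the columns of B, the hypotheses give B = B′ V,
  -- C′ B′ = d for C′ = V C, and an integral R′ with σ B′ = B′ R′, so that
  -- tr (σ B C) = tr (B′ R′ C′) = tr (R′ C′ B′) = d · tr R′.
  trace-divisible : ∀ {v k} (d : ℤ) (B : Matrix v k) (C : Matrix k v) (R : Matrix k k)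
    (σ : Fin v → Fin v) → (λ i → B (σ i)) ≋ B ⊛ R → (B ⊛ C) ⊛ B ≋ (λ i j → d * B i j) →
    d ∣ trace (λ i → (B ⊛ C) (σ i))
  trace-divisible {v} {k} d B C R σ σB≋BR BCB≋dB = divides (trace R′) (begin
    trace (λ i → (B ⊛ C) (σ i))  ≡⟨ sum-cong-≗ (λ i → σBC≋ i i) ⟩
    trace (B′ ⊛ (R′ ⊛ C′))       ≡⟨ trace-comm B′ (R′ ⊛ C′) ⟩
    trace ((R′ ⊛ C′) ⊛ B′)       ≡⟨ sum-cong-≗ (λ i → ⊛-assoc R′ C′ B′ i i) ⟩
    trace (R′ ⊛ (C′ ⊛ B′))       ≡⟨ sum-cong-≗ (λ i → ⊛-congˡ {A = R′} C′B′≋d i i) ⟩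
    ∑[ i < rank ] ∑[ j < rank ] (R′ i j * (δ j i * d))
      ≡⟨ sum-cong-≗ (λ i → sum-cong-≗ (λ j → sym (*-assoc (R′ i j) (δ j i) d))) ⟩
    ∑[ i < rank ] ∑[ j < rank ] (R′ i j * δ j i * d)
      ≡⟨ sum-cong-≗ (λ i → trans (sym (*-distribʳ-sum d (λ j → R′ i j * δ j i)))
                                (cong (_* d) (sum-*δ (R′ i) i))) ⟩
    ∑[ i < rank ] (R′ i i * d)   ≡⟨ *-distribʳ-sum d (λ i → R′ i i) ⟨
    trace R′ * d                 ∎)
    where
    open ColumnBasis (columnBasis B) renaming (basis to B′)
    -- Column coordinates pass from `B′` to `B` by `U` and back by `V`; this turns `R` into an
    -- integer matrix acting on the basis.
    R′ : Matrix rank rank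
    R′ = V ⊛ (R ⊛ U)
    C′ : Matrix rank v
    C′ = V ⊛ C
    BC≋B′C′ : B ⊛ C ≋ B′ ⊛ C′
    BC≋B′C′ i j = trans (⊛-congʳ {B = C} B≋basis⊛V i j) (⊛-assoc B′ V C i j)
    σB′≋B′R′ : (λ i → B′ (σ i)) ≋ B′ ⊛ R′
    σB′≋B′R′ i j = begin
      B′ (σ i) j                ≡⟨ basis≋B⊛U (σ i) j ⟩
      (B ⊛ U) (σ i) j           ≡⟨ ⊛-congʳ {B = U} σB≋BR i j ⟩
      ((B ⊛ R) ⊛ U) i j         ≡⟨ ⊛-assoc B R U i j ⟩
      (B ⊛ (R ⊛ U)) i j         ≡⟨ ⊛-congʳ {B = R ⊛ U} B≋basis⊛V i j ⟩
      ((B′ ⊛ V) ⊛ (R ⊛ U)) i j  ≡⟨ ⊛-assoc B′ V (R ⊛ U) i j ⟩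
      (B′ ⊛ R′) i j             ∎
    σBC≋ : (λ i → (B ⊛ C) (σ i)) ≋ B′ ⊛ (R′ ⊛ C′)
    σBC≋ i j = begin
      (B ⊛ C) (σ i) j         ≡⟨ BC≋B′C′ (σ i) j ⟩
      (B′ ⊛ C′) (σ i) j       ≡⟨ ⊛-congʳ {B = C′} σB′≋B′R′ i j ⟩
      ((B′ ⊛ R′) ⊛ C′) i j    ≡⟨ ⊛-assoc B′ R′ C′ i j ⟩
      (B′ ⊛ (R′ ⊛ C′)) i j    ∎
    B′C′B′≋dB′ : B′ ⊛ (C′ ⊛ B′) ≋ (λ i j → d * B′ i j)
    B′C′B′≋dB′ i j = begin
      (B′ ⊛ (C′ ⊛ B′)) i j        ≡⟨ ⊛-assoc B′ C′ B′ i j ⟨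
      ((B′ ⊛ C′) ⊛ B′) i j        ≡⟨ ⊛-cong {B = B′} (λ i j → sym (BC≋B′C′ i j)) basis≋B⊛U i j ⟩
      ((B ⊛ C) ⊛ (B ⊛ U)) i j     ≡⟨ ⊛-assoc (B ⊛ C) B U i j ⟨
      (((B ⊛ C) ⊛ B) ⊛ U) i j     ≡⟨ ⊛-congʳ {B = U} BCB≋dB i j ⟩
      ∑[ l < k ] (d * B i l * U l j)    ≡⟨ sum-cong-≗ (λ l → *-assoc d (B i l) (U l j)) ⟩
      ∑[ l < k ] (d * (B i l * U l j))  ≡⟨ *-distribˡ-sum d (λ l → B i l * U l j) ⟨
      d * (B ⊛ U) i j             ≡⟨ cong (d *_) (basis≋B⊛U i j) ⟨
      d * B′ i j                  ∎
    -- Linear independence of the columns allows `B′` to be cancelled on the left of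
    -- `B′ C′ B′ = d B′`.
    C′B′≋d : C′ ⊛ B′ ≋ (λ j l → δ j l * d)
    C′B′≋d j l = i-j≡0⇒i≡j _ _ (injective (λ j → (C′ ⊛ B′) j l - δ j l * d) (λ i → begin
      ∑[ j < rank ] (B′ i j * ((C′ ⊛ B′) j l - δ j l * d))
        ≡⟨ sum-cong-≗ (λ j → distr (B′ i j) ((C′ ⊛ B′) j l) (δ j l) d) ⟩
      ∑[ j < rank ] (B′ i j * (C′ ⊛ B′) j l - B′ i j * δ j l * d)
        ≡⟨ sum-- (λ j → B′ i j * (C′ ⊛ B′) j l) (λ j → B′ i j * δ j l * d) ⟩
      (B′ ⊛ (C′ ⊛ B′)) i l - ∑[ j < rank ] (B′ i j * δ j l * d)
        ≡⟨ cong₂ _-_ (B′C′B′≋dB′ i l) (trans (sym (*-distribʳ-sum d (λ j → B′ i j * δ j l)))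
             (cong (_* d) (sum-*δ (B′ i) l))) ⟩
      d * B′ i l - B′ i l * d  ≡⟨ cong (_-_ (d * B′ i l)) (*-comm (B′ i l) d) ⟩
      d * B′ i l - d * B′ i l  ≡⟨ +-inverseʳ (d * B′ i l) ⟩
      0ℤ                       ∎) j)
      where
      distr : ∀ b c e d → b * (c - e * d) ≡ b * c - b * e * d
      distr = solve-∀

-- Incidence matrices of generalized quadrangles.

module Quadrangle where

  open IntegerMatrices
  open import Data.Nat using (ℕ; zero; suc; pred)
  open import Data.Bool using (Bool; true; false; _∧_; not)
  open import Data.Integer hiding (suc; pred)
  open import Data.Integer.Properties hiding (_≟_)
  open import Data.Integer.Divisibility.Signed using (_∣_)
  open import Data.Integer.Tactic.RingSolver using (solve-∀)
  open import Data.Fin using (Fin; zero; suc)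
  import Data.Fin as Fin
  open import Data.Product using (_,_)
  open import Function using (_∘_)
  open import Relation.Binary.PropositionalEquality
  open import Relation.Nullary using (¬_; yes; no; contradiction)
  open import Relation.Nullary.Decidable using (⌊_⌋)
  open import Algebra.Properties.Semiring.Sum +-*-semiring
  open ≡-Reasoning

  ⟦_⟧ : Bool → ℤ
  ⟦ true  ⟧ = 1ℤ
  ⟦ false ⟧ = 0ℤ

  ⟦∧⟧ : ∀ a b → ⟦ a ∧ b ⟧ ≡ ⟦ a ⟧ * ⟦ b ⟧
  ⟦∧⟧ false b = refl
  ⟦∧⟧ true  b = sym (*-identityˡ ⟦ b ⟧)

  countF≡sum : ∀ {n} (f : Fin n → Bool) → + countF f ≡ ∑[ i < n ] ⟦ f i ⟧
  countF≡sum {zero}  f = refl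
  countF≡sum {suc n} f with f zero
  ... | true  = cong (_+_ 1ℤ) (countF≡sum (f ∘ suc))
  ... | false = trans (countF≡sum (f ∘ suc)) (sym (+-identityˡ _))

  δ-refl : ∀ {n} (i : Fin n) → δ i i ≡ 1ℤ
  δ-refl zero    = refl
  δ-refl (suc i) = δ-refl i

  δ-≢ : ∀ {n} {i j : Fin n} → i ≢ j → δ i j ≡ 0ℤ
  δ-≢ {i = zero}  {zero}  i≢j = contradiction refl i≢j
  δ-≢ {i = zero}  {suc j} i≢j = refl
  δ-≢ {i = suc i} {zero}  i≢j = refl
  δ-≢ {i = suc i} {suc j} i≢j = δ-≢ (i≢j ∘ cong suc)

  sum-δ : ∀ {n} (l : Fin n) → ∑[ j < n ] δ j l ≡ 1ℤ
  sum-δ l = trans (sum-cong-≗ λ j → sym (*-identityˡ (δ j l))) (sum-*δ (λ _ → 1ℤ) l)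

  -- Turns uniqueness statements, such as the GQ axiom, into values of sums.
  sum-concentrated : ∀ {n} (f : Fin n → ℤ) l → f l ≡ 1ℤ → (∀ j → j ≢ l → f j ≡ 0ℤ) → sum f ≡ 1ℤ
  sum-concentrated f l fl≡1 f≡0 = trans (sum-cong-≗ pointwise) (sum-δ l)
    where
    pointwise : ∀ j → f j ≡ δ j l
    pointwise j with j Fin.≟ l
    ... | yes refl = trans fl≡1 (sym (δ-refl j))
    ... | no  j≢l  = trans (f≡0 j j≢l) (sym (δ-≢ j≢l))

  module _ {np nl : ℕ} (I : Incidence np nl) where

    D : Matrix np nl
    D p L = ⟦ I p L ⟧

    Dᵀ : Matrix nl np
    Dᵀ L p = D p L

    M : Matrix np np
    M = D ⊛ Dᵀ

    D≡1 : ∀ {p L} → I p L ≡ true → D p L ≡ 1ℤ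
    D≡1 = cong ⟦_⟧

    M-not-collinear : ∀ {p q} → ¬ Collinear I p q → M p q ≡ 0ℤ
    M-not-collinear {p} {q} ¬pq = sum-zero term
      where
      term : ∀ L → D p L * D q L ≡ 0ℤ
      term L with I p L in pL | I q L in qL
      ... | true  | true  = contradiction (L , pL , qL) ¬pq
      ... | true  | false = refl
      ... | false | _     = refl

    module _ {s t : ℕ} (gq : IsGQ I s t) where
      open IsGQ gq

      pointDegree : ∀ p → ∑[ L < nl ] D p L ≡ 1ℤ + + t
      pointDegree p = trans (sym (countF≡sum (I p))) (cong +_ (pointDeg p))

      lineLength : ∀ L → ∑[ p < np ] D p L ≡ 1ℤ + + s
      lineLength L = trans (sym (countF≡sum (λ p → I p L))) (cong +_ (lineSize L))

      M-diagonal : ∀ p → M p p ≡ 1ℤ + + t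
      M-diagonal p = trans (sum-cong-≗ λ L → idem (I p L)) (pointDegree p)
        where
        idem : ∀ b → ⟦ b ⟧ * ⟦ b ⟧ ≡ ⟦ b ⟧
        idem true  = refl
        idem false = refl

      M-collinear : ∀ {p q} → p ≢ q → Collinear I p q → M p q ≡ 1ℤ
      M-collinear {p} {q} p≢q (K , pK , qK) =
        sum-concentrated (λ L → D p L * D q L) K (cong₂ _*_ (D≡1 pK) (D≡1 qK)) others
        where
        others : ∀ L → L ≢ K → D p L * D q L ≡ 0ℤ
        others L L≢K with I p L in pL | I q L in qL
        ... | true  | true  = contradiction (atMostOne p q L K p≢q pL qL pK qK) L≢K
        ... | true  | false = refl
        ... | false | _     = refl

      -- Double counting over the lines through `p`. Only the independence of `p` matters later: the
      -- sums cancel when two rows are subtracted.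
      M-rowSum : ∀ p → ∑[ q < np ] M p q ≡ (1ℤ + + t) * (1ℤ + + s)
      M-rowSum p = begin
        ∑[ q < np ] ∑[ L < nl ] (D p L * D q L)  ≡⟨ ∑-comm (λ q L → D p L * D q L) ⟩
        ∑[ L < nl ] ∑[ q < np ] (D p L * D q L)  ≡⟨ sum-cong-≗ (λ L → *-distribˡ-sum (D p L) (λ q → D q L)) ⟨
        ∑[ L < nl ] (D p L * ∑[ q < np ] D q L)  ≡⟨ sum-cong-≗ (λ L → cong (D p L *_) (lineLength L)) ⟩
        ∑[ L < nl ] (D p L * (1ℤ + + s))         ≡⟨ *-distribʳ-sum (1ℤ + + s) (D p) ⟨
        (∑[ L < nl ] D p L) * (1ℤ + + s)         ≡⟨ cong (_* (1ℤ + + s)) (pointDegree p) ⟩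
        (1ℤ + + t) * (1ℤ + + s)                  ∎

      -- Off `L`, the GQ axiom leaves exactly one point of `L` collinear with `p`. On `L`, each of
      -- the `s + 1` points contributes one, and `p` itself contributes `t` more through its
      -- diagonal entry.
      M⊛D : ∀ p L → (M ⊛ D) p L ≡ 1ℤ + (+ s + + t) * D p L
      M⊛D p L with I p L in pL
      ... | false with gqAxiom p L pL
      ...   | q₀ , (q₀L , pq₀) , unique = trans
              (sum-concentrated (λ q → M p q * D q L) q₀
                (cong₂ _*_ (M-collinear p≢q₀ pq₀) (D≡1 q₀L)) others)
              (sym (trans (cong (_+_ 1ℤ) (*-zeroʳ (+ s + + t))) refl))
        where
        p≢q₀ : p ≢ q₀
        p≢q₀ refl = contradiction (trans (sym pL) q₀L) λ ()
        others : ∀ q → q ≢ q₀ → M p q * D q L ≡ 0ℤ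
        others q q≢q₀ with I q L in qL
        ... | true  = cong (_* 1ℤ) (M-not-collinear λ pq → q≢q₀ (unique q qL pq))
        ... | false = *-zeroʳ (M p q)
      M⊛D p L | true = begin
        ∑[ q < np ] (M p q * D q L)                            ≡⟨ sum-cong-≗ term ⟩
        ∑[ q < np ] (D q L + + t * δ q p)                      ≡⟨ ∑-distrib-+ (λ q → D q L) (λ q → + t * δ q p) ⟩
        ∑[ q < np ] D q L + ∑[ q < np ] (+ t * δ q p)          ≡⟨ cong₂ _+_ (lineLength L) (sum-*δ (λ _ → + t) p) ⟩
        1ℤ + + s + + t                                         ≡⟨ regroup (+ s) (+ t) ⟩
        1ℤ + (+ s + + t) * 1ℤ                                  ∎
        where
        regroup : ∀ s t → 1ℤ + s + t ≡ 1ℤ + (s + t) * 1ℤ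
        regroup = solve-∀
        diagonal : ∀ t → (1ℤ + t) * 1ℤ ≡ 1ℤ + t * 1ℤ
        diagonal = solve-∀
        term : ∀ q → M p q * D q L ≡ D q L + + t * δ q p
        term q with q Fin.≟ p
        ... | yes refl = begin
          M q q * D q L           ≡⟨ cong₂ _*_ (M-diagonal q) (D≡1 pL) ⟩
          (1ℤ + + t) * 1ℤ         ≡⟨ diagonal (+ t) ⟩
          1ℤ + + t * 1ℤ           ≡⟨ cong₂ (λ d e → d + + t * e) (D≡1 pL) (δ-refl q) ⟨
          D q L + + t * δ q q     ∎
        ... | no q≢p = trans (off-diagonal q q≢p)
          (sym (trans (cong (λ e → D q L + + t * e) (δ-≢ q≢p))
                      (trans (cong (_+_ (D q L)) (*-zeroʳ (+ t))) (+-identityʳ (D q L)))))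
          where
          off-diagonal : ∀ q → q ≢ p → M p q * D q L ≡ D q L
          off-diagonal q q≢p with I q L in qL
          ... | true  = cong (_* 1ℤ) (M-collinear (q≢p ∘ sym) (L , pL , qL))
          ... | false = *-zeroʳ (M p q)

      module _ (x : Fin np) where

        -- Subtracting the row of x removes the eigenvalue (s + 1)(t + 1) of M, so that E Dᵀ acts on
        -- the columns of E as the scalar s + t.
        E : Matrix np nl
        E p L = D p L - D x L

        E⊛Dᵀ : ∀ p q → (E ⊛ Dᵀ) p q ≡ M p q - M x q
        E⊛Dᵀ p q = trans (sum-cong-≗ λ L → *-distribʳ-- (D p L) (D x L) (D q L))
                         (sum-- (λ L → D p L * D q L) (λ L → D x L * D q L))
          where
          *-distribʳ-- : ∀ a b c → (a - b) * c ≡ a * c - b * c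
          *-distribʳ-- = solve-∀

        EDᵀE : (E ⊛ Dᵀ) ⊛ E ≋ (λ p L → (+ s + + t) * E p L)
        EDᵀE p L = begin
          ∑[ q < np ] ((E ⊛ Dᵀ) p q * E q L)
            ≡⟨ sum-cong-≗ (λ q → cong (_* E q L) (E⊛Dᵀ p q)) ⟩
          ∑[ q < np ] ((M p q - M x q) * (D q L - D x L))
            ≡⟨ sum-cong-≗ (λ q → expand (M p q) (M x q) (D q L) (D x L)) ⟩
          ∑[ q < np ] ((M p q * D q L - M x q * D q L) - (M p q - M x q) * D x L)
            ≡⟨ sum-- (λ q → M p q * D q L - M x q * D q L) (λ q → (M p q - M x q) * D x L) ⟩
          ∑[ q < np ] (M p q * D q L - M x q * D q L) - ∑[ q < np ] ((M p q - M x q) * D x L)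
            ≡⟨ cong₂ _-_ (sum-- (λ q → M p q * D q L) (λ q → M x q * D q L))
                         (trans (sym (*-distribʳ-sum (D x L) (λ q → M p q - M x q)))
                                (cong (_* D x L) (trans (sum-- (M p) (M x)) (cong₂ _-_ (M-rowSum p) (M-rowSum x))))) ⟩
          -- The constant ones of `M ⊛ D` cancel between the rows of `p` and `x`, and the equal row
          -- sums remove the last term.
          ((M ⊛ D) p L - (M ⊛ D) x L) - (κ - κ) * D x L
            ≡⟨ cong₂ (λ a b → (a - b) - (κ - κ) * D x L) (M⊛D p L) (M⊛D x L) ⟩
          ((1ℤ + d * D p L) - (1ℤ + d * D x L)) - (κ - κ) * D x L
            ≡⟨ collect d κ (D p L) (D x L) ⟩
          d * E p L ∎
          where
          d = + s + + t
          κ = (1ℤ + + t) * (1ℤ + + s)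
          expand : ∀ a b c e → (a - b) * (c - e) ≡ (a * c - b * c) - (a - b) * e
          expand = solve-∀
          collect : ∀ d k a b → ((1ℤ + d * a) - (1ℤ + d * b)) - (k - k) * b ≡ d * (a - b)
          collect = solve-∀

    -- Automorphisms fixing every line through a point.

    module _ {s t : ℕ} (gq : IsGQ I s t) (x : Fin np) (a : Aut I)
             (fixesLines : ∀ L → I x L ≡ true → ln a L ≡ L) where
      open IsGQ gq

      pt-ln : ∀ p L → I (pt a p) L ≡ I p (lnInv a L)
      pt-ln p L = trans (cong (I (pt a p)) (sym (lnInvʳ a L))) (preserves a p (lnInv a L))

      -- The inverse also fixes the lines through `x`, and no other line is sent to one of them.
      -- Hence the row subtracted in `E` is invariant under the column permutation.
      x-lnInv : ∀ L → I x (lnInv a L) ≡ I x L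
      x-lnInv L with I x L in xL | I x (lnInv a L) in xL′
      ... | true  | true  = refl
      ... | false | false = refl
      ... | true  | false = trans (sym xL′)
              (trans (cong (I x) (trans (cong (lnInv a) (sym (fixesLines L xL))) (lnInvˡ a L))) xL)
      ... | false | true  = trans (sym xL′)
              (trans (cong (I x) (trans (sym (fixesLines _ xL′)) (lnInvʳ a L))) xL)

      -- Permuting the rows of `E` by `a` amounts to multiplying on the right by the permutation
      -- matrix of `lnInv a`, so the lattice argument applies to `E` and `Dᵀ`.
      benson : (+ s + + t) ∣ trace (λ p → (E gq x ⊛ Dᵀ) (pt a p))
      benson = trace-divisible (+ s + + t) (E gq x) Dᵀ (λ K L → δ K (lnInv a L)) (pt a)
        (λ p L → trans (cong₂ (λ u v → ⟦ u ⟧ - ⟦ v ⟧) (pt-ln p L) (sym (x-lnInv L)))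
                       (sym (sum-*δ (E gq x p) (lnInv a L))))
        (EDᵀE gq x)

      fixed-∈ : ∀ {p L} → ln a L ≡ L → I p L ≡ true → I (pt a p) L ≡ true
      fixed-∈ {p} {L} aL≡L pL =
        trans (cong (I (pt a p)) (sym aL≡L)) (trans (preserves a p L) pL)

      -- Let u be the point of L collinear with x and K the line xu. A second point y of L with
      -- a y on L gives a triangle u, a u, a y unless a fixes u, and then a L = L.
      moved-meet : ∀ {L y} → I x L ≡ false → I y L ≡ true → I (pt a y) L ≡ true →
                   pt a y ≢ y → ln a L ≡ L
      moved-meet {L} {y} xL yL ayL ay≢y with gqAxiom x L xL
      ... | u , (uL , K , xK , uK) , _ = helper
        where
        aK≡K : ln a K ≡ K
        aK≡K = fixesLines K xK
        K≢L : K ≢ L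
        K≢L refl = contradiction (trans (sym xL) xK) λ ()
        auK : I (pt a u) K ≡ true
        auK = fixed-∈ aK≡K uK
        ay∉K : I (pt a y) K ≡ false
        ay∉K with I (pt a y) K in ayK
        ... | false = refl
        -- If `pt a y` were on the fixed line `K`, so would be `y`; two distinct common points would
        -- identify `K` with `L`.
        ... | true  = contradiction
          (atMostOne (pt a y) y K L ay≢y ayK
            (trans (sym (preserves a y K)) (trans (cong (I (pt a y)) aK≡K) ayK)) ayL yL) K≢L
        helper : ln a L ≡ L
        helper with gqAxiom (pt a y) K ay∉K
        -- Both `ln a L` and `L` contain `pt a y` and `u`, which differ because only `u` is on `K`.
        ... | v , _ , unique = atMostOne (pt a y) u (ln a L) L ay≢u
                (trans (preserves a y L) yL)
                (subst (λ z → I z (ln a L) ≡ true) au≡u (trans (preserves a u L) uL)) ayL uL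
          where
          -- The points `u` and `pt a u` of `K` are both collinear with `pt a y`, via `L` and
          -- `ln a L`, so the GQ axiom identifies them.
          au≡u : pt a u ≡ u
          au≡u = trans (unique (pt a u) auK (ln a L , trans (preserves a y L) yL , trans (preserves a u L) uL))
                       (sym (unique u uK (L , ayL , uL)))
          ay≢u : pt a y ≢ u
          ay≢u ay≡u = contradiction (trans (sym ay∉K) (trans (cong (λ z → I z K) ay≡u) uK)) λ ()

      -- The trace when all fixed points lie on one line through `x`.

      module _ (La : Fin nl) (xLa : I x La ≡ true) (fixed⇒∈La : ∀ q → pt a q ≡ q → I q La ≡ true) where

        F : Fin np → ℤ
        F p = ⟦ ⌊ pt a p Fin.≟ p ⌋ ⟧

        affine : Fin nl → ℤ
        affine L = ⟦ not (I x L) ⟧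

        fixed : Fin nl → ℤ
        fixed L = ⟦ ⌊ ln a L Fin.≟ L ⌋ ⟧

        F≡1 : ∀ {p} → pt a p ≡ p → F p ≡ 1ℤ
        F≡1 {p} ap≡p with pt a p Fin.≟ p
        ... | yes _   = refl
        ... | no ap≢p = contradiction ap≡p ap≢p

        F≡0 : ∀ {p} → pt a p ≢ p → F p ≡ 0ℤ
        F≡0 {p} ap≢p with pt a p Fin.≟ p
        ... | yes ap≡p = contradiction ap≡p ap≢p
        ... | no _     = refl

        -- The point of `L` collinear with `x` is fixed by uniqueness. Any fixed point of `L` lies
        -- on `La`, hence is collinear with `x` and is that same point.
        fixedPoints-on-fixedLine : ∀ {L} → I x L ≡ false → ln a L ≡ L → ∑[ p < np ] (F p * D p L) ≡ 1ℤ
        fixedPoints-on-fixedLine {L} xL aL≡L with gqAxiom x L xL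
        ... | u , (uL , K , xK , uK) , unique =
          sum-concentrated (λ p → F p * D p L) u (cong₂ _*_ (F≡1 au≡u) (D≡1 uL)) others
          where
          au≡u : pt a u ≡ u
          au≡u = unique (pt a u) (fixed-∈ aL≡L uL) (K , xK , fixed-∈ (fixesLines K xK) uK)
          others : ∀ p → p ≢ u → F p * D p L ≡ 0ℤ
          others p p≢u with pt a p Fin.≟ p | I p L in pL
          ... | no _     | _     = refl
          ... | yes _    | false = refl
          ... | yes ap≡p | true  = contradiction (unique p pL (La , xLa , fixed⇒∈La p ap≡p)) p≢u

        -- On a fixed line all `s + 1` points stay on `L` and exactly one of them is fixed; on any
        -- other affine line `moved-meet` lets only fixed points stay.
        moved-along-affine : ∀ {L} → I x L ≡ false →
          ∑[ p < np ] (D (pt a p) L * D p L) ≡ + s * fixed L + ∑[ p < np ] (F p * D p L)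
        moved-along-affine {L} xL with ln a L Fin.≟ L
        ... | yes aL≡L = begin
          ∑[ p < np ] (D (pt a p) L * D p L)  ≡⟨ sum-cong-≗ term ⟩
          ∑[ p < np ] D p L                   ≡⟨ lineLength gq L ⟩
          1ℤ + + s                            ≡⟨ +-comm 1ℤ (+ s) ⟩
          + s + 1ℤ                            ≡⟨ cong₂ _+_ (*-identityʳ (+ s)) (fixedPoints-on-fixedLine xL aL≡L) ⟨
          + s * 1ℤ + ∑[ p < np ] (F p * D p L) ∎
          where
          term : ∀ p → D (pt a p) L * D p L ≡ D p L
          term p with I p L in pL
          ... | true  = cong (_* 1ℤ) (D≡1 (fixed-∈ aL≡L pL))
          ... | false = *-zeroʳ (D (pt a p) L)
        ... | no aL≢L = begin
          ∑[ p < np ] (D (pt a p) L * D p L)    ≡⟨ sum-cong-≗ term ⟩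
          ∑[ p < np ] (F p * D p L)             ≡⟨ +-identityˡ _ ⟨
          0ℤ + ∑[ p < np ] (F p * D p L)        ≡⟨ cong (_+ ∑[ p < np ] (F p * D p L)) (*-zeroʳ (+ s)) ⟨
          + s * 0ℤ + ∑[ p < np ] (F p * D p L)  ∎
          where
          term : ∀ p → D (pt a p) L * D p L ≡ F p * D p L
          term p with pt a p Fin.≟ p
          ... | yes ap≡p = begin
            D (pt a p) L * D p L  ≡⟨ cong (λ z → D z L * D p L) ap≡p ⟩
            D p L * D p L         ≡⟨ idem (I p L) ⟩
            1ℤ * D p L            ∎
            where
            idem : ∀ b → ⟦ b ⟧ * ⟦ b ⟧ ≡ 1ℤ * ⟦ b ⟧
            idem true  = refl
            idem false = refl
          ... | no ap≢p with I p L in pL | I (pt a p) L in apL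
          ...   | true  | true  = contradiction (moved-meet xL pL apL ap≢p) aL≢L
          ...   | true  | false = refl
          ...   | false | b     = *-zeroʳ ⟦ b ⟧

        -- The lines through x are fixed and contribute nothing to the trace.
        column : ∀ L → ∑[ p < np ] (E gq x (pt a p) L * D p L) ≡
                 + s * (affine L * fixed L) + ∑[ p < np ] (F p * (affine L * D p L))
        column L with I x L in xL
        ... | true  = trans (sum-zero term) (sym (cong₂ _+_ (*-zeroʳ (+ s)) (sum-zero λ p → *-zeroʳ (F p))))
          where
          term : ∀ p → (D (pt a p) L - 1ℤ) * D p L ≡ 0ℤ
          term p with I p L in pL
          ... | true  = cong (λ z → (z - 1ℤ) * 1ℤ) (D≡1 (fixed-∈ (fixesLines L xL) pL))
          ... | false = *-zeroʳ (D (pt a p) L - 1ℤ)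
        ... | false = begin
          ∑[ p < np ] ((D (pt a p) L - 0ℤ) * D p L)
            ≡⟨ sum-cong-≗ (λ p → cong (_* D p L) (+-identityʳ (D (pt a p) L))) ⟩
          ∑[ p < np ] (D (pt a p) L * D p L)
            ≡⟨ moved-along-affine xL ⟩
          + s * fixed L + ∑[ p < np ] (F p * D p L)
            ≡⟨ cong₂ (λ u v → + s * u + v) (*-identityˡ (fixed L))
                 (sum-cong-≗ λ p → cong (F p *_) (*-identityˡ (D p L))) ⟨
          + s * (1ℤ * fixed L) + ∑[ p < np ] (F p * (1ℤ * D p L)) ∎

        module _ (t≢0 : t ≢ 0) where

          -- Every line through `x` is fixed, so it also contains `pt a x`. Were this a second
          -- point, all these lines would equal `La`, leaving degree `t + 1 = 1`.
          ax≡x : pt a x ≡ x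
          ax≡x with pt a x Fin.≟ x
          ... | yes eq    = eq
          ... | no  ax≢x  = contradiction t≡0 t≢0
            where
            unique : ∀ L → L ≢ La → D x L ≡ 0ℤ
            unique L L≢La with I x L in xL
            ... | false = refl
            ... | true  = contradiction
              (atMostOne x (pt a x) L La (ax≢x ∘ sym) xL (fixed-∈ (fixesLines L xL) xL)
                xLa (fixed-∈ (fixesLines La xLa) xLa)) L≢La
            t≡0 : t ≡ 0
            t≡0 = cong pred (+-injective
              (trans (sym (pointDegree gq x)) (sum-concentrated (D x) La (D≡1 xLa) unique)))

          affineLinesThrough : ∀ p → ∑[ L < nl ] (affine L * D p L) ≡ 1ℤ + + t - M x p
          affineLinesThrough p = begin
            ∑[ L < nl ] (affine L * D p L)             ≡⟨ sum-cong-≗ (λ L → complement (I x L) (D p L)) ⟩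
            ∑[ L < nl ] (D p L - D x L * D p L)        ≡⟨ sum-- (D p) (λ L → D x L * D p L) ⟩
            ∑[ L < nl ] D p L - M x p                  ≡⟨ cong (_- M x p) (pointDegree gq p) ⟩
            1ℤ + + t - M x p                           ∎
            where
            complement : ∀ b c → ⟦ not b ⟧ * c ≡ c - ⟦ b ⟧ * c
            complement true  c = sym (trans (cong (_-_ c) (*-identityˡ c)) (+-inverseʳ c))
            complement false c = trans (*-identityˡ c) (sym (+-identityʳ c))

          -- A fixed point other than `x` lies on `La`, the only non-affine line through it, so `t`
          -- affine lines remain. No affine line passes through `x`, whence the correction by
          -- `δ p x`.
          fixedPoint-contribution : ∀ p →
            F p * (1ℤ + + t - M x p) ≡ + t * ⟦ I p La ∧ ⌊ pt a p Fin.≟ p ⌋ ⟧ - + t * δ p x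
          fixedPoint-contribution p with p Fin.≟ x
          ... | yes refl = begin
            F x * (1ℤ + + t - M x x)    ≡⟨ cong (λ z → F x * (1ℤ + + t - z)) (M-diagonal gq x) ⟩
            F x * (1ℤ + + t - (1ℤ + + t)) ≡⟨ lem (F x) (+ t) ⟩
            + t * 1ℤ - + t * 1ℤ         ≡⟨ cong₂ (λ u v → + t * u - + t * v) eq (δ-refl x) ⟨
            + t * ⟦ I x La ∧ ⌊ pt a x Fin.≟ x ⌋ ⟧ - + t * δ x x ∎
            where
            lem : ∀ f t → f * (1ℤ + t - (1ℤ + t)) ≡ t * 1ℤ - t * 1ℤ
            lem = solve-∀
            eq : ⟦ I x La ∧ ⌊ pt a x Fin.≟ x ⌋ ⟧ ≡ 1ℤ
            eq = trans (⟦∧⟧ (I x La) _) (cong₂ _*_ (D≡1 xLa) (F≡1 ax≡x))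
          ... | no p≢x = trans (off-centre p p≢x) (sym (trans
                (cong (λ z → + t * ⟦ I p La ∧ ⌊ pt a p Fin.≟ p ⌋ ⟧ - + t * z) (δ-≢ p≢x))
                (lem (+ t) ⟦ I p La ∧ ⌊ pt a p Fin.≟ p ⌋ ⟧)))
            where
            lem : ∀ t c → t * c - t * 0ℤ ≡ t * c
            lem = solve-∀
            cancel : ∀ t → 1ℤ * (1ℤ + t - 1ℤ) ≡ t * (1ℤ * 1ℤ)
            cancel = solve-∀
            off-centre : ∀ p → p ≢ x → F p * (1ℤ + + t - M x p) ≡ + t * ⟦ I p La ∧ ⌊ pt a p Fin.≟ p ⌋ ⟧
            off-centre p p≢x with pt a p Fin.≟ p
            ... | yes ap≡p = begin
              1ℤ * (1ℤ + + t - M x p)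
                ≡⟨ cong (λ z → 1ℤ * (1ℤ + + t - z)) (M-collinear gq (p≢x ∘ sym) (La , xLa , pLa)) ⟩
              1ℤ * (1ℤ + + t - 1ℤ)       ≡⟨ cancel (+ t) ⟩
              + t * (1ℤ * 1ℤ)            ≡⟨ cong (λ z → + t * (z * 1ℤ)) (D≡1 pLa) ⟨
              + t * (D p La * 1ℤ)        ≡⟨ cong (+ t *_) (⟦∧⟧ (I p La) true) ⟨
              + t * ⟦ I p La ∧ true ⟧    ∎
              where
              pLa : I p La ≡ true
              pLa = fixed⇒∈La p ap≡p
            ... | no _ = sym (trans (cong (+ t *_) (trans (⟦∧⟧ (I p La) false) (*-zeroʳ (D p La)))) (*-zeroʳ (+ t)))

          -- The column sums split into fixed affine lines and pairs of a fixed point with an affine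
          -- line through it; the pairs are then recounted point by point.
          trace-count : ∀ {α} → fixedPointsOn I a La ≡ suc α →
            trace (λ p → (E gq x ⊛ Dᵀ) (pt a p)) ≡ + s * + fixedAffineLines I x a + + t * + α
          trace-count {α} count = begin
            ∑[ p < np ] ∑[ L < nl ] (E gq x (pt a p) L * D p L)
              ≡⟨ ∑-comm (λ p L → E gq x (pt a p) L * D p L) ⟩
            ∑[ L < nl ] ∑[ p < np ] (E gq x (pt a p) L * D p L)
              ≡⟨ sum-cong-≗ column ⟩
            ∑[ L < nl ] (+ s * (affine L * fixed L) + ∑[ p < np ] (F p * (affine L * D p L)))
              ≡⟨ ∑-distrib-+ (λ L → + s * (affine L * fixed L)) (λ L → ∑[ p < np ] (F p * (affine L * D p L))) ⟩
            ∑[ L < nl ] (+ s * (affine L * fixed L)) + ∑[ L < nl ] ∑[ p < np ] (F p * (affine L * D p L))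
              ≡⟨ cong₂ _+_ lines points ⟩
            + s * + fixedAffineLines I x a + + t * + α ∎
            where
            lines : ∑[ L < nl ] (+ s * (affine L * fixed L)) ≡ + s * + fixedAffineLines I x a
            lines = begin
              ∑[ L < nl ] (+ s * (affine L * fixed L))  ≡⟨ *-distribˡ-sum (+ s) (λ L → affine L * fixed L) ⟨
              + s * ∑[ L < nl ] (affine L * fixed L)
                ≡⟨ cong (+ s *_) (sum-cong-≗ λ L → ⟦∧⟧ (not (I x L)) ⌊ ln a L Fin.≟ L ⌋) ⟨
              + s * ∑[ L < nl ] ⟦ not (I x L) ∧ ⌊ ln a L Fin.≟ L ⌋ ⟧
                ≡⟨ cong (+ s *_) (countF≡sum (λ L → not (I x L) ∧ ⌊ ln a L Fin.≟ L ⌋)) ⟨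
              + s * + fixedAffineLines I x a ∎
            points : ∑[ L < nl ] ∑[ p < np ] (F p * (affine L * D p L)) ≡ + t * + α
            points = begin
              ∑[ L < nl ] ∑[ p < np ] (F p * (affine L * D p L))
                ≡⟨ ∑-comm (λ L p → F p * (affine L * D p L)) ⟩
              ∑[ p < np ] ∑[ L < nl ] (F p * (affine L * D p L))
                ≡⟨ sum-cong-≗ (λ p → trans (sym (*-distribˡ-sum (F p) (λ L → affine L * D p L)))
                     (trans (cong (F p *_) (affineLinesThrough p)) (fixedPoint-contribution p))) ⟩
              ∑[ p < np ] (+ t * onLa p - + t * δ p x)
                ≡⟨ sum-- (λ p → + t * onLa p) (λ p → + t * δ p x) ⟩
              ∑[ p < np ] (+ t * onLa p) - ∑[ p < np ] (+ t * δ p x)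
                ≡⟨ cong₂ _-_ (sym (*-distribˡ-sum (+ t) onLa)) (sum-*δ (λ _ → + t) x) ⟩
              + t * ∑[ p < np ] onLa p - + t
                ≡⟨ cong (λ z → + t * z - + t)
                     (trans (sym (countF≡sum (λ p → I p La ∧ ⌊ pt a p Fin.≟ p ⌋))) (cong +_ count)) ⟩
              + t * (1ℤ + + α) - + t
                -- wait
                ≡⟨ lem (+ t) (+ α) ⟩
              + t * + α ∎
              where
              onLa : Fin np → ℤ
              onLa p = ⟦ I p La ∧ ⌊ pt a p Fin.≟ p ⌋ ⟧
              lem : ∀ t a → t * (1ℤ + a) - t ≡ t * a
              lem = solve-∀

-- Divisors of prime powers.

module PrimePowers where

  open import Data.Nat
  open import Data.Nat.Properties
  open import Data.Nat.Divisibility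
  open import Data.Nat.Primality
  open import Data.Nat.Coprimality using (Coprime; coprime-divisor)
  open import Data.Nat.Tactic.RingSolver using (solve-∀)
  open import Data.Integer using (ℤ; +_; -[1+_])
  open import Data.Integer.Divisibility using () renaming (_∣_ to _∣ℤ_)
  open import Data.Product
  open import Data.Sum using (inj₁; inj₂)
  open import Relation.Binary.PropositionalEquality
  open import Relation.Nullary

  prime∤⇒coprime : ∀ {p m} → Prime p → ¬ (p ∣ m) → Coprime m p
  prime∤⇒coprime pr p∤m (d∣m , d∣p) with prime⇒irreducible pr d∣p
  ... | inj₁ d≡1  = d≡1
  ... | inj₂ refl = contradiction d∣m p∤m

  -- Induction on `k`: a divisor prime to `p` already divides the next lower power, and otherwise
  -- one factor `p` is removed from both sides.
  ∣p^k⇒isPowerOf : ∀ {p m} → Prime p → ∀ k → m ∣ p ^ k → IsPowerOf p m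
  ∣p^k⇒isPowerOf pr zero m∣1 = 0 , ∣1⇒≡1 m∣1
  ∣p^k⇒isPowerOf {p} {m} pr (suc k) m∣ with p ∣? m
  ... | no p∤m = ∣p^k⇒isPowerOf pr k (coprime-divisor (prime∤⇒coprime pr p∤m) m∣)
  ... | yes (divides m′ refl) with ∣p^k⇒isPowerOf {m = m′} pr k
          (*-cancelˡ-∣ p {{prime⇒nonZero pr}} (subst (_∣ p ^ suc k) (*-comm m′ p) m∣))
  ...   | j , m′≡ = suc j , trans (*-comm m′ p) (cong (p *_) m′≡)

  ∣p^k∧∤p⇒≡1 : ∀ {p m} → Prime p → ∀ k → ¬ (p ∣ m) → m ∣ p ^ k → m ≡ 1
  ∣p^k∧∤p⇒≡1 pr k p∤m m∣ with ∣p^k⇒isPowerOf pr k m∣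
  ... | zero  , m≡1 = m≡1
  ... | suc j , m≡  = contradiction (subst (_ ∣_) (sym m≡) (m∣m*n _)) p∤m

  ^-distribʳ-* : ∀ m n o → (m * n) ^ o ≡ m ^ o * n ^ o
  ^-distribʳ-* m n zero    = refl
  ^-distribʳ-* m n (suc o) = trans (cong (m * n *_) (^-distribʳ-* m n o)) (lem m n (m ^ o) (n ^ o))
    where
    lem : ∀ a b c d → a * b * (c * d) ≡ a * c * (b * d)
    lem = solve-∀

  -- The order of `p` modulo `q + 1`.

  module Order (p : ℕ) (1<p : 1 < p) (n : ℕ) where

    private instance
      p≢0 : NonZero p
      p≢0 = >-nonZero (<-trans z<s 1<p)

    q : ℕ
    q = p ^ n

    0<p^ : ∀ e → 0 < p ^ e
    0<p^ e = m^n>0 p e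

    suc[q]∤p^r+1 : ∀ {r} → r < n → ¬ (suc q ∣ suc (p ^ r))
    suc[q]∤p^r+1 {r} r<n div =
      <⇒≱ (s<s (^-monoʳ-< p 1<p r<n)) (∣⇒≤ div)

    -- For `r ≤ n` the number is smaller than `q + 1`, so divisibility forces it to be zero.
    suc[q]∣p^r∸1⇒r≡0 : ∀ {r} → r ≤ n → suc q ∣ p ^ r ∸ 1 → r ≡ 0
    suc[q]∣p^r∸1⇒r≡0 {zero}  _   _   = refl
    suc[q]∣p^r∸1⇒r≡0 {suc r} r<n div =
      contradiction (∣⇒≤ {{>-nonZero (m<n⇒0<n∸m 1<p^)}} div)
        (<⇒≱ (s≤s (≤-trans (m∸n≤m _ 1) (^-monoʳ-≤ p r<n))))
      where
      1<p^ : 1 < p ^ suc r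
      1<p^ = <-≤-trans 1<p (m≤m*n p (p ^ r) {{>-nonZero (0<p^ r)}})

    -- Modulo q + 1 we have pⁿ ≡ −1, so lowering the exponent by n turns p^e − 1 into −(p^(e−n) + 1)
    -- and p^e + 1 into −(p^(e−n) − 1).
    minus-step : ∀ e → suc q ∣ p ^ (n + e) ∸ 1 → suc q ∣ suc (p ^ e)
    minus-step e div = ∣m+n∣m⇒∣n (subst (suc q ∣_) eq (n∣m*n (p ^ e))) div
      where
      eq : p ^ e * suc q ≡ (p ^ (n + e) ∸ 1) + suc (p ^ e)
      eq = begin-equality
        p ^ e * suc q                       ≡⟨ *-suc (p ^ e) q ⟩
        p ^ e + p ^ e * q                   ≡⟨ cong (_+_ (p ^ e)) (*-comm (p ^ e) q) ⟩
        p ^ e + q * p ^ e                   ≡⟨ cong (_+_ (p ^ e)) (^-distribˡ-+-* p n e) ⟨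
        p ^ e + p ^ (n + e)                 ≡⟨ cong (_+_ (p ^ e)) (m+[n∸m]≡n (0<p^ (n + e))) ⟨
        p ^ e + suc (p ^ (n + e) ∸ 1)       ≡⟨ lem (p ^ e) _ ⟩
        (p ^ (n + e) ∸ 1) + suc (p ^ e)     ∎
        where
        open ≤-Reasoning
        lem : ∀ a b → a + (1 + b) ≡ b + (1 + a)
        lem = solve-∀

    plus-step : ∀ e → suc q ∣ suc (p ^ (n + e)) → suc q ∣ p ^ e ∸ 1
    plus-step e div = ∣m+n∣m⇒∣n (subst (suc q ∣_) eq (n∣m*n (p ^ e))) div
      where
      eq : p ^ e * suc q ≡ suc (p ^ (n + e)) + (p ^ e ∸ 1)
      eq = begin-equality
        p ^ e * suc q                       ≡⟨ *-suc (p ^ e) q ⟩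
        p ^ e + p ^ e * q                   ≡⟨ cong (_+_ (p ^ e)) (*-comm (p ^ e) q) ⟩
        p ^ e + q * p ^ e                   ≡⟨ cong (_+_ (p ^ e)) (^-distribˡ-+-* p n e) ⟨
        p ^ e + p ^ (n + e)                 ≡⟨ cong (_+ (p ^ (n + e))) (m+[n∸m]≡n (0<p^ e)) ⟨
        suc (p ^ e ∸ 1) + p ^ (n + e)       ≡⟨ cong suc (+-comm (p ^ e ∸ 1) _) ⟩
        suc (p ^ (n + e)) + (p ^ e ∸ 1)     ∎
        where open ≤-Reasoning

    -- Two lowerings by `n` return to the same form with exponent `e − 2n`. Below `n` only `e = 0`
    -- survives by size; from `n` up to `2n`, one lowering gives a number `p ^ r + 1` too small to
    -- be a multiple of `q + 1`.
    order : 0 < n → ∀ e → suc q ∣ p ^ e ∸ 1 → Σ[ c ∈ ℕ ] e ≡ n * (2 * c)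
    order 0<n e = go e e ≤-refl
      where
      -- Recursion is on `bound`, since the exponent drops by `2n` rather than structurally; `0 < n`
      -- makes the drop strict.
      go : ∀ bound e → e ≤ bound → suc q ∣ p ^ e ∸ 1 → Σ[ c ∈ ℕ ] e ≡ n * (2 * c)
      go bound e e≤ div with n ≤? e
      ... | no n≰e = 0 , trans (suc[q]∣p^r∸1⇒r≡0 (<⇒≤ (≰⇒> n≰e)) div) (sym (*-zeroʳ n))
      ... | yes n≤e with m≤n⇒∃[o]m+o≡n n≤e
      ...   | r , refl with n ≤? r
      ...     | no n≰r = contradiction (minus-step r div) (suc[q]∤p^r+1 (≰⇒> n≰r))
      ...     | yes n≤r with m≤n⇒∃[o]m+o≡n n≤r
      go zero e e≤ div | yes n≤e | r , refl | yes _ | r′ , refl = contradiction (≤-trans (≤-trans 0<n n≤e) e≤) λ ()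
      go (suc bound) e e≤ div | yes n≤e | r , refl | yes _ | r′ , refl
        with go bound r′ (s≤s⁻¹ (≤-trans shrink e≤)) (plus-step r′ (minus-step (n + r′) div))
        where
        shrink : suc r′ ≤ n + (n + r′)
        shrink = +-mono-≤ 0<n (m≤n+m r′ n)
      ... | c , refl = suc c , lem n c
        where
        lem : ∀ n c → n + (n + n * (2 * c)) ≡ n * (2 * (1 + c))
        lem = solve-∀

  ratioPow⁺ : ∀ {α f s t} c → α * t ^ (2 * c) ≡ f * s ^ (2 * c) →
    Σ[ o ∈ ℤ ] ((+ 2 ∣ℤ o) × RatioPow α f s t o)
  ratioPow⁺ c eq = + (2 * c) , m∣m*n c , eq

  ratioPow⁻ : ∀ {α f s t} c → α * s ^ (2 * c) ≡ f * t ^ (2 * c) →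
    Σ[ o ∈ ℤ ] ((+ 2 ∣ℤ o) × RatioPow α f s t o)
  ratioPow⁻ zero    eq = + 0 , (2 ∣0) , eq
  -- `-[1+ n ]` stands for `−(n + 1)`, and `2 * suc c` reduces to the successor of the number given
  -- here.
  ratioPow⁻ (suc c) eq = -[1+ (c + suc (c + 0)) ] , m∣m*n (suc c) , eq

  -- From divisibility by `s + t` to the exponent of `s / t`.

  module _ {p} (pr : Prime p) {s t} (1<s : 2 ≤ s) (1<t : 2 ≤ t) (t<s : t < s) where

    private
      instance
        p≢0 : NonZero p
        p≢0 = prime⇒nonZero pr

      1<p : 1 < p
      1<p = nonTrivial⇒n>1 p {{prime⇒nonTrivial pr}}

    -- As divisors of a power of `p`, both `s` and `t` are powers of `p`; `t < s` makes the
    -- difference of exponents positive, hence `suc n`.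
    powers⇒quotient : IsPowerOf p (s * t) → Σ[ n ∈ ℕ ] s ≡ t * p ^ suc n
    powers⇒quotient (k , st≡) with ∣p^k⇒isPowerOf pr k (subst (s ∣_) st≡ (m∣m*n t))
                               | ∣p^k⇒isPowerOf pr k (subst (t ∣_) st≡ (n∣m*n s))
    ... | i , refl | j , refl with i ≤? j
    ...   | yes i≤j = contradiction (^-monoʳ-≤ p i≤j) (<⇒≱ t<s)
    ...   | no  i≰j with m≤n⇒∃[o]m+o≡n (≰⇒> i≰j)
    ...     | n , refl = n , trans (cong (p ^_) (sym (+-suc j n))) (^-distribˡ-+-* p j (suc n))

    ratioFromDivisibility : ∀ {α f} → IsPowerOf p (s * t) → s + t ∣ s * f + t * α → IsPowerOf p α →
      (f ≢ 0) × (IsPowerOf p f → Σ[ o ∈ ℤ ] ((+ 2 ∣ℤ o) × RatioPow α f s t o))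
    ratioFromDivisibility {f = f} st-power div (k , refl) with powers⇒quotient st-power
    ... | n , refl = f≢0 , ratio
      where
      open Order p 1<p (suc n)

      div′ : suc q ∣ q * f + p ^ k
      div′ = *-cancelˡ-∣ t {{>-nonZero (<-trans z<s 1<t)}} (subst₂ _∣_ (lem₁ t q) (lem₂ t q f (p ^ k)) div)
        where
        lem₁ : ∀ t q → t * q + t ≡ t * (1 + q)
        lem₁ = solve-∀
        lem₂ : ∀ t q f a → t * q * f + t * a ≡ t * (q * f + a)
        lem₂ = solve-∀

      p∤suc[q] : ¬ (p ∣ suc q)
      p∤suc[q] p∣ = <⇒≢ 1<p (sym (∣1⇒≡1 (∣m+n∣m⇒∣n (subst (p ∣_) (+-comm 1 q) p∣) (m∣m*n (p ^ n)))))

      -- A common divisor of `suc q` and `p ^ m` is a power of `p` not divisible by `p`, so it is 1.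
      cancel : ∀ m {z} → suc q ∣ p ^ m * z → suc q ∣ z
      cancel m = coprime-divisor λ (d∣suc[q] , d∣p^m) →
        ∣p^k∧∤p⇒≡1 pr m (λ p∣d → p∤suc[q] (∣-trans p∣d d∣suc[q])) d∣p^m

      -- With `f` zero, `suc q` would divide `p ^ k` and, being prime to `p`, equal 1.
      f≢0 : f ≢ 0
      f≢0 refl = <⇒≢ (s<s (0<p^ (suc n)))
        (sym (∣p^k∧∤p⇒≡1 pr k p∤suc[q] (subst (λ z → suc q ∣ z + p ^ k) (*-zeroʳ q) div′)))

      -- Here `q` is `s / t`, so a gap of `suc n * (2 * c)` between exponents of `p` is the factor
      -- `(s / t) ^ (2 * c)`.
      scale : ∀ m c → p ^ (m + suc n * (2 * c)) * t ^ (2 * c) ≡ p ^ m * (t * q) ^ (2 * c)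
      scale m c = begin
        p ^ (m + suc n * (2 * c)) * t ^ (2 * c)
          ≡⟨ cong (_* (t ^ (2 * c))) (^-distribˡ-+-* p m (suc n * (2 * c))) ⟩
        p ^ m * p ^ (suc n * (2 * c)) * t ^ (2 * c)
          ≡⟨ cong (λ z → p ^ m * z * t ^ (2 * c)) (^-*-assoc p (suc n) (2 * c)) ⟨
        p ^ m * q ^ (2 * c) * t ^ (2 * c)
          ≡⟨ lem (p ^ m) (q ^ (2 * c)) (t ^ (2 * c)) ⟩
        p ^ m * (t ^ (2 * c) * q ^ (2 * c))
          ≡⟨ cong (_*_ (p ^ m)) (^-distribʳ-* t q (2 * c)) ⟨
        p ^ m * (t * q) ^ (2 * c) ∎
        where
        open ≡-Reasoning
        lem : ∀ a b c → a * b * c ≡ a * (c * b)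
        lem = solve-∀

      ratio : IsPowerOf p f → Σ[ o ∈ ℤ ] ((+ 2 ∣ℤ o) × RatioPow (p ^ k) f (t * q) t o)
      ratio (m , refl) with ≤-total m k
      -- Dividing by `p ^ m` leaves `q + p ^ e`, which is `p ^ e ∸ 1` modulo `suc q`.
      ... | inj₁ m≤k with m≤n⇒∃[o]m+o≡n m≤k
      ...   | e , refl with order z<s e
                (∣m+n∣m⇒∣n (subst (suc q ∣_) q+p^e≡ (cancel m (subst (suc q ∣_) factor div′))) ∣-refl)
        where
        factor : q * p ^ m + p ^ (m + e) ≡ p ^ m * (q + p ^ e)
        factor = trans (cong (_+_ (q * p ^ m)) (^-distribˡ-+-* p m e)) (lem q (p ^ m) (p ^ e))
          where
          lem : ∀ q a b → q * a + a * b ≡ a * (q + b)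
          lem = solve-∀
        q+p^e≡ : q + p ^ e ≡ suc q + (p ^ e ∸ 1)
        q+p^e≡ = trans (cong (_+_ q) (sym (m+[n∸m]≡n (0<p^ e)))) (+-suc q (p ^ e ∸ 1))
      ...     | c , refl = ratioPow⁺ c (scale m c)
      -- Dividing by `p ^ k` leaves `q * p ^ e + 1`; its sum with `p ^ e ∸ 1` is a multiple of
      -- `suc q`. Now `f` is the larger power, so the exponent is nonpositive.
      ratio (m , refl) | inj₂ k≤m with m≤n⇒∃[o]m+o≡n k≤m
      ...   | e , refl with order z<s e
                (∣m+n∣m⇒∣n (subst (suc q ∣_) [q+1]p^e≡ (m∣m*n (p ^ e)))
                           (cancel k (subst (suc q ∣_) factor div′)))
        where
        factor : q * p ^ (k + e) + p ^ k ≡ p ^ k * (q * p ^ e + 1)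
        factor = trans (cong (λ z → q * z + p ^ k) (^-distribˡ-+-* p k e)) (lem q (p ^ k) (p ^ e))
          where
          lem : ∀ q a b → q * (a * b) + a ≡ a * (q * b + 1)
          lem = solve-∀
        [q+1]p^e≡ : suc q * p ^ e ≡ (q * p ^ e + 1) + (p ^ e ∸ 1)
        [q+1]p^e≡ = begin
          p ^ e + q * p ^ e                    ≡⟨ +-comm (p ^ e) _ ⟩
          q * p ^ e + p ^ e                    ≡⟨ cong (_+_ (q * p ^ e)) (m+[n∸m]≡n (0<p^ e)) ⟨
          q * p ^ e + (1 + (p ^ e ∸ 1))        ≡⟨ +-assoc (q * p ^ e) 1 _ ⟨
          (q * p ^ e + 1) + (p ^ e ∸ 1)        ∎
          where open ≡-Reasoning
      ...     | c , refl = ratioPow⁻ c (sym (scale k c))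

open import Data.Nat using (ℕ; suc; _*_; _≤_; _<_)
open import Data.Nat.Primality using (Prime)
open import Data.Integer using (ℤ; +_)
open import Data.Integer.Divisibility using () renaming (_∣_ to _∣ℤ_)
open import Data.Fin using (Fin)
open import Data.Bool using (true)
open import Data.Product using (Σ-syntax; _×_)
open import Relation.Binary.PropositionalEquality using (_≡_; _≢_; sym; trans; cong; cong₂; subst)
open import Relation.Nullary using (¬_)
import Data.Nat as ℕ
import Data.Nat.Divisibility as ℕ
open import Data.Nat.Properties using (m<n⇒n≢0)
import Data.Integer as ℤ
open import Data.Integer.Properties using (pos-*)
open import Data.Integer.Divisibility.Signed using (∣⇒∣ᵤ)
open Quadrangle using (benson; trace-count)
open PrimePowers using (ratioFromDivisibility)

mainTheorem7 : ∀ {np nl : ℕ} (I : Incidence np nl) (s t : ℕ) (x : Fin np)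
    (G : Aut I → Set) → IsEGQ I s t x G →
    2 ≤ s → 2 ≤ t → t < s →
    (p : ℕ) → Prime p → IsPowerOf p (s * t) →
    (a : Aut I) → G a → ¬ ((∀ q → pt a q ≡ q) × (∀ L → ln a L ≡ L)) →
    (La : Fin nl) → I x La ≡ true → (∀ q → pt a q ≡ q → I q La ≡ true) →
    (α : ℕ) → fixedPointsOn I a La ≡ suc α → IsPowerOf p α →
    (fixedAffineLines I x a ≢ 0)
    × (IsPowerOf p (fixedAffineLines I x a) →
    Σ[ o ∈ ℤ ] ((+ 2 ∣ℤ o) × RatioPow α (fixedAffineLines I x a) s t o))
mainTheorem7 I s t x G egq 1<s 1<t t<s p pr st-power a Ga _ La xLa fixed⇒∈La α count α-power =
  ratioFromDivisibility pr 1<s 1<t t<s st-power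
    -- Absolute values turn divisibility over ℤ into divisibility over ℕ, the trace being the image
    -- of `s * f + t * α`.
    (subst (s ℕ.+ t ℕ.∣_) (cong ℤ.∣_∣ trace≡) (∣⇒∣ᵤ (benson I isGQ x a (fixesLines a Ga)))) α-power
  where
  open IsEGQ egq
  f : ℕ
  f = fixedAffineLines I x a
  trace≡ = trans
    (trace-count I isGQ x a (fixesLines a Ga) La xLa fixed⇒∈La (m<n⇒n≢0 1<t) count)
    (sym (cong₂ ℤ._+_ (pos-* s f) (pos-* t α)))
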